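{- For every integer $n \ge 0$, let $w(n) = n+1$ if $n$ is evil and $w(n) = 0$ if $n$ is odious. Then $w(n) \equiv m(n) \pmod 2$ for all $n \ge 0$.
   Context: For a non-negative integer $k$, $s_2(k)$ denotes the number of ones in the binary expansion of $k$; $k$ is called evil if $s_2(k)$ is even and odious if $s_2(k)$ is odd. Define $\bar{t}(k) = 1$ if $k$ is evil and $\bar{t}(k)=0$ if $k$ is odious. The sequence $m(n)$, $n \ge 0$, is defined by $m(2k) = \bar{t}(k)$ and $m(2k+1) = 0$ for all $k \ge 0$. The sequence $w(n)$ is OEIS A102393, indexed from $n=0$: $1,0,0,4,0,6,7,0,0,10,\ldots$. -}

module Defs where

open import Data.Bool.Base using (if_then_else_)
open import Data.Digit using (1b; toDigits)
open import Data.Fin.Properties using (_≟_)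
open import Data.List.Base using ([]; _∷_; filter; length; map; upTo)
open import Data.Nat.Base using (ℕ; _+_; _*_; _/_)
open import Data.Nat.Divisibility using (_∣_; _∣?_; m∣m*n; ∣m+n∣m⇒∣n; ∣1⇒≡1)
open import Data.Nat.DivMod using (m*n/n≡m)
open import Data.Nat.Properties using (*-comm)
open import Data.Product.Base using (proj₁)
open import Relation.Binary.PropositionalEquality using (_≡_; refl; cong; trans)
open import Relation.Nullary.Decidable using (Dec; does; dec-true; dec-false)
open import Relation.Nullary.Negation using (¬_; contradiction)

s₂ : ℕ → ℕ
s₂ k = length (filter (_≟ 1b) (proj₁ (toDigits 2 k)))

Evil : ℕ → Set
Evil k = 2 ∣ s₂ k

Odious : ℕ → Set
Odious k = ¬ Evil k

evil? : ∀ k → Dec (Evil k)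
evil? k = 2 ∣? s₂ k

t̄ : ℕ → ℕ
t̄ k = if does (evil? k) then 1 else 0

m : ℕ → ℕ
m n = if does (2 ∣? n) then t̄ (n / 2) else 0

w : ℕ → ℕ
w n = if does (evil? n) then n + 1 else 0

t̄-evil : ∀ {k} → Evil k → t̄ k ≡ 1
t̄-evil {k} e = cong (if_then 1 else 0) (dec-true (evil? k) e)

t̄-odious : ∀ {k} → Odious k → t̄ k ≡ 0
t̄-odious {k} o = cong (if_then 1 else 0) (dec-false (evil? k) o)

m-even : ∀ k → m (2 * k) ≡ t̄ k
m-even k = trans
  (cong (if_then t̄ (2 * k / 2) else 0) (dec-true (2 ∣? 2 * k) (m∣m*n k)))
  (cong t̄ (trans (cong (_/ 2) (*-comm 2 k)) (m*n/n≡m k 2)))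

m-odd : ∀ k → m (2 * k + 1) ≡ 0
m-odd k = cong (if_then t̄ ((2 * k + 1) / 2) else 0)
  (dec-false (2 ∣? 2 * k + 1)
    λ 2∣ → contradiction (∣1⇒≡1 (∣m+n∣m⇒∣n 2∣ (m∣m*n k))) λ ())

w-evil : ∀ {n} → Evil n → w n ≡ n + 1
w-evil {n} e = cong (if_then n + 1 else 0) (dec-true (evil? n) e)

w-odious : ∀ {n} → Odious n → w n ≡ 0
w-odious {n} o = cong (if_then n + 1 else 0) (dec-false (evil? n) o)

w-initial : map w (upTo 10) ≡ 1 ∷ 0 ∷ 0 ∷ 4 ∷ 0 ∷ 6 ∷ 7 ∷ 0 ∷ 0 ∷ 10 ∷ []
w-initial = refl

{-# OPTIONS --safe #-}
-- The number of ones of a binary expansion depends only on its value, even when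
-- leading zeros are allowed.  Prepending the digit 0 therefore gives s₂ (2k) = s₂ k,
-- so 2k is evil exactly when k is.  For even n this settles the congruence, since
-- n + 1 is odd; for odd n both n + 1 and 0 are even.
module Submission where

open import Defs
open import Data.Digit using (Expansion; 0b; 1b; fromDigits; toDigits)
open import Data.Fin.Base using (zero; suc)
open import Data.Fin.Properties using (_≟_)
open import Data.List.Base using ([]; _∷_; filter; length)
open import Data.Nat.Base using (ℕ; _%_; suc; _+_; _*_)
open import Data.Nat.Divisibility using (_∣_; m∣m*n)
open import Data.Nat.DivMod using (_divMod_; result; %-remove-+ˡ)
open import Data.Nat.Properties
  using (*-comm; +-assoc; +-comm; *-cancelʳ-≡; even≢odd; suc-injective)
open import Data.Product.Base using (proj₁; proj₂)
open import Relation.Binary.PropositionalEquality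
  using (_≡_; _≢_; refl; sym; trans; cong; subst; subst₂; module ≡-Reasoning)
open import Relation.Nullary.Decidable using (yes; no)
open import Relation.Nullary.Negation using (contradiction)

ones : Expansion 2 → ℕ
ones ds = length (filter (_≟ 1b) ds)

-- A head digit 1 would make the value a successor, so that case is absurd and only zeros remain.
ones-zero : ∀ ds → fromDigits {2} ds ≡ 0 → ones ds ≡ 0
ones-zero []          _  = refl
ones-zero (zero ∷ ds) eq = ones-zero ds (*-cancelʳ-≡ _ 0 2 eq)

m*2≢1+n*2 : ∀ m n → m * 2 ≢ suc (n * 2)
m*2≢1+n*2 m n eq =
  even≢odd m n (subst₂ (λ a b → a ≡ suc b) (*-comm m 2) (*-comm n 2) eq)

-- The head digit is the parity of the value, so the heads agree and cancelling the factor 2 passes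
-- to the tails. Once one list runs out, the other has value 0.
ones-cong : ∀ ds es → fromDigits ds ≡ fromDigits es → ones ds ≡ ones es
ones-cong []              es              eq = sym (ones-zero es (sym eq))
ones-cong ds@(_ ∷ _)      []              eq = ones-zero ds eq
ones-cong (zero ∷ ds)     (zero ∷ es)     eq =
  ones-cong ds es (*-cancelʳ-≡ _ _ 2 eq)
ones-cong (zero ∷ ds)     (suc zero ∷ es) eq =
  contradiction eq (m*2≢1+n*2 (fromDigits ds) (fromDigits es))
ones-cong (suc zero ∷ ds) (zero ∷ es)     eq =
  contradiction (sym eq) (m*2≢1+n*2 (fromDigits es) (fromDigits ds))
ones-cong (suc zero ∷ ds) (suc zero ∷ es) eq =
  cong suc (ones-cong ds es (*-cancelʳ-≡ _ _ 2 (suc-injective eq)))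

s₂-double : ∀ k → s₂ (2 * k) ≡ s₂ k
-- Digits run from the least significant, so consing `0b` doubles the value. For `k = 0` the two
-- lists differ, by a leading zero.
s₂-double k = ones-cong (proj₁ (toDigits 2 (2 * k))) (0b ∷ proj₁ (toDigits 2 k)) (begin
  fromDigits (proj₁ (toDigits 2 (2 * k)))  ≡⟨ proj₂ (toDigits 2 (2 * k)) ⟩
  2 * k                                    ≡⟨ *-comm 2 k ⟩
  k * 2                                    ≡⟨ cong (_* 2) (proj₂ (toDigits 2 k)) ⟨
  fromDigits (0b ∷ proj₁ (toDigits 2 k))   ∎)
  where open ≡-Reasoning

w≡m-even : ∀ k → w (2 * k) % 2 ≡ m (2 * k) % 2
-- The split is on `k` because `m (2 * k)` is `t̄ k`; `s₂-double` carries the answer over to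
-- `2 * k`.
w≡m-even k with evil? k
... | yes e = begin
  w (2 * k) % 2    ≡⟨ cong (_% 2) (w-evil {2 * k} (subst (2 ∣_) (sym (s₂-double k)) e)) ⟩
  (2 * k + 1) % 2  ≡⟨ %-remove-+ˡ 1 (m∣m*n k) ⟩
  1                ≡⟨ cong (_% 2) (trans (m-even k) (t̄-evil {k} e)) ⟨
  m (2 * k) % 2    ∎
  where open ≡-Reasoning
... | no o = cong (_% 2) (begin
  w (2 * k)  ≡⟨ w-odious {2 * k} (λ e → o (subst (2 ∣_) (s₂-double k) e)) ⟩
  0          ≡⟨ trans (m-even k) (t̄-odious {k} o) ⟨
  m (2 * k)  ∎)
  where open ≡-Reasoning

w-odd : ∀ k → w (2 * k + 1) % 2 ≡ 0
w-odd k with evil? (2 * k + 1)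
... | yes e = begin
  w (2 * k + 1) % 2    ≡⟨ cong (_% 2) (w-evil {2 * k + 1} e) ⟩
  (2 * k + 1 + 1) % 2  ≡⟨ cong (_% 2) (+-assoc (2 * k) 1 1) ⟩
  (2 * k + 2) % 2      ≡⟨ %-remove-+ˡ 2 (m∣m*n k) ⟩
  0                    ∎
  where open ≡-Reasoning
... | no o = cong (_% 2) (w-odious {2 * k + 1} o)

w≡m-odd : ∀ k → w (2 * k + 1) % 2 ≡ m (2 * k + 1) % 2
w≡m-odd k = trans (w-odd k) (cong (_% 2) (sym (m-odd k)))

-- Kept abstract in P: a with-abstraction in lemma3 itself would unfold the goal
-- and also capture the divisions by 2 inside toDigits.
parity-elim : ∀ {p} (P : ℕ → Set p) →
              (∀ k → P (2 * k)) → (∀ k → P (2 * k + 1)) → ∀ n → P n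
parity-elim P even odd n with n divMod 2
... | result k zero       eq = subst P (sym (trans eq (*-comm k 2))) (even k)
-- Here `eq` reduces to `n ≡ suc (k * 2)`, with the remainder first.
... | result k (suc zero) eq =
  subst P (sym (trans eq (trans (cong suc (*-comm k 2)) (+-comm 1 (2 * k))))) (odd k)

lemma3 : (n : ℕ) → w n % 2 ≡ m n % 2
lemma3 = parity-elim (λ n → w n % 2 ≡ m n % 2) w≡m-even w≡m-odd
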